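{- For every \textsc{Strip Cover} instance $(x,b)$, $\mathrm{RR}(x,b)=\sum_{i=1}^n b_i/r_i\ge\frac{2}{3}\,\mathrm{Opt}_{SC}(x,b)$, where $r_i=\max\{x_i,1-x_i\}$ and $\mathrm{Opt}_{SC}(x,b)$ is the optimal \textsc{Strip Cover} lifetime. That is, \textsc{RoundRobin} is a $\frac{3}{2}$-approximation algorithm for \textsc{Strip Cover}.
   Context: \textsc{Strip Cover}: An instance is a pair $(x,b)$, where $x=(x_1,\ldots,x_n)\in[0,1]^n$ with $x_1\le\cdots\le x_n$ are sensor locations and $b=(b_1,\ldots,b_n)$, $b_i\ge0$ rational, are battery charges. A solution is a vector $\rho(t)=(\rho_1(t),\ldots,\rho_n(t))$ of piecewise constant functions $\rho_i:[0,\infty)\to[0,\infty)$ with finitely many pieces (the radius of sensor $i$ at time $t$), subject to $\int_0^\infty\rho_i(t)\,dt\le b_i$ for every $i$. The interval $[0,1]$ is covered at time $t$ if $[0,1]\subseteq\bigcup_i[x_i-\rho_i(t),x_i+\rho_i(t)]$. The lifetime of a solution is the maximum $T$ such that $[0,1]$ is covered at all $t\in[0,T]$; $\mathrm{Opt}_{SC}(x,b)$ is the maximum lifetime. The \textsc{RoundRobin} solution lets the sensors take turns in order $1,\ldots,n$, sensor $i$ alone using radius $r_i=\max\{x_i,1-x_i\}$ (which covers $[0,1]$) for $b_i/r_i$ time units, giving lifetime $\mathrm{RR}(x,b)=\sum_i b_i/r_i$. -}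

module Defs where

open import Algebra.Bundles using (CommutativeRing)
open import Data.Bool.Base using (if_then_else_)
open import Data.Fin.Base as Fin using (Fin; toℕ; inject)
open import Data.Integer.Base using (ℤ; +_; -[1+_])
open import Data.Nat.Base as ℕ using (ℕ; suc)
open import Data.Product using (_×_; ∃)
open import Data.Rational.Base as ℚ using (ℚ; 0ℚ; ↥_; ↧ₙ_)
open import Data.Sum.Base using (_⊎_)
open import Function.Definitions using (Congruent)
open import Level using (_⊔_) renaming (suc to lsuc)
open import Relation.Binary.Bundles using (DecTotalOrder)
open import Relation.Binary.Core using (Rel)
open import Relation.Binary.PropositionalEquality.Core using (_≡_)
open import Relation.Binary.Structures using (IsDecTotalOrder)
open import Relation.Nullary.Decidable.Core
  using (Dec; does; ¬?; _⊎-dec_; _×-dec_)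
open import Relation.Nullary.Negation.Core using (¬_)
import Algebra.Construct.NaturalChoice.Max as Max
import Algebra.Definitions.RawMonoid as RawMonoidOps
import Algebra.Properties.CommutativeMonoid.Sum as Sum
import Data.Nat.Properties as ℕₚ

-- The real numbers enter only through this structure.  Classically ℝ is an
-- instance, as is ℚ; neither completeness nor the Archimedean property is
-- assumed.
record OrderedField c ℓ₁ ℓ₂ : Set (lsuc (c ⊔ ℓ₁ ⊔ ℓ₂)) where
  infix  8 _⁻¹
  infix  4 _≤_
  field
    commutativeRing : CommutativeRing c ℓ₁
  open CommutativeRing commutativeRing public
  field
    _≤_             : Rel Carrier ℓ₂
    isDecTotalOrder : IsDecTotalOrder _≈_ _≤_
    +-monoʳ-≤       : ∀ z {x y} → x ≤ y → z + x ≤ z + y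
    *-nonneg        : ∀ {x y} → 0# ≤ x → 0# ≤ y → 0# ≤ x * y
    0≉1             : ¬ 0# ≈ 1#
    -- Total, with an unspecified value at 0#.
    _⁻¹             : Carrier → Carrier
    ⁻¹-inverseʳ     : ∀ x → ¬ x ≈ 0# → x * x ⁻¹ ≈ 1#

  decTotalOrder : DecTotalOrder c ℓ₁ ℓ₂
  decTotalOrder = record { isDecTotalOrder = isDecTotalOrder }

  open DecTotalOrder decTotalOrder public using (_≤?_; _≟_; totalOrder)
  open Max totalOrder public using () renaming (_⊔_ to max)
  open Sum +-commutativeMonoid public using (sum)
  open RawMonoidOps +-rawMonoid using () renaming (_×_ to _·_)

  infix 4 _<_
  _<_ : Rel Carrier ℓ₂
  x < y = ¬ y ≤ x

  fromℤ : ℤ → Carrier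
  fromℤ (+ n)    = n · 1#
  fromℤ -[1+ n ] = - (suc n · 1#)

  fromℚ : ℚ → Carrier
  fromℚ q = fromℤ (↥ q) * (↧ₙ q · 1#) ⁻¹

module StripCover {c ℓ₁ ℓ₂} (F : OrderedField c ℓ₁ ℓ₂) where
  open OrderedField F

  record Instance (n : ℕ) : Set (c ⊔ ℓ₂) where
    field
      x        : Fin n → Carrier
      0≤x      : ∀ i → 0# ≤ x i
      x≤1      : ∀ i → x i ≤ 1#
      x-sorted : ∀ {i j} → i Fin.≤ j → x i ≤ x j
      b        : Fin n → ℚ
      0≤b      : ∀ i → 0ℚ ℚ.≤ b i

  -- `Pieces f s` says that f takes finitely many values on (s, ∞) away from
  -- the breakpoints.  The values at the breakpoints are unconstrained, so every
  -- finite mixture of open, closed, half-open and one-point pieces is allowed.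
  data Pieces (f : Carrier → Carrier) (s : Carrier) : Set (c ⊔ ℓ₁ ⊔ ℓ₂) where
    last  : ∀ v → (∀ t → s < t → f t ≈ v) → Pieces f s
    piece : ∀ s′ v → s ≤ s′ → (∀ t → s < t → t < s′ → f t ≈ v) →
            Pieces f s′ → Pieces f s

  finalValue : ∀ {f s} → Pieces f s → Carrier
  finalValue (last v _)        = v
  finalValue (piece _ _ _ _ p) = finalValue p

  area : ∀ {f s} → Pieces f s → Carrier
  area         (last _ _)         = 0#
  area {s = s} (piece s′ v _ _ p) = v * (s′ - s) + area p

  -- For f ≥ 0 the integral over [0, ∞) is finite only if the final value is 0.
  Integral≤ : ∀ {f} → Pieces f 0# → Carrier → Set (ℓ₁ ⊔ ℓ₂)
  Integral≤ p β = finalValue p ≈ 0# × area p ≤ β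

  module _ {n : ℕ} (I : Instance n) where
    open Instance I

    -- ρ i t is the radius of sensor i at time t; only t ≥ 0 is meaningful.
    Radii : Set c
    Radii = Fin n → Carrier → Carrier

    record IsSolution (ρ : Radii) : Set (c ⊔ ℓ₁ ⊔ ℓ₂) where
      field
        ρ-cong : ∀ i → Congruent _≈_ _≈_ (ρ i)
        0≤ρ    : ∀ i t → 0# ≤ t → 0# ≤ ρ i t
        pieces : ∀ i → Pieces (ρ i) 0#
        budget : ∀ i → Integral≤ (pieces i) (fromℚ (b i))

    CoveredAt : Radii → Carrier → Set (c ⊔ ℓ₂)
    CoveredAt ρ t = ∀ y → 0# ≤ y → y ≤ 1# →
      ∃ λ i → x i - ρ i t ≤ y × y ≤ x i + ρ i t

    CoveredUntil : Radii → Carrier → Set (c ⊔ ℓ₂)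
    CoveredUntil ρ T = 0# ≤ T × (∀ t → 0# ≤ t → t ≤ T → CoveredAt ρ t)

    IsLifetime : Radii → Carrier → Set (c ⊔ ℓ₂)
    IsLifetime ρ T = CoveredUntil ρ T × (∀ T′ → CoveredUntil ρ T′ → T′ ≤ T)

    IsOpt : Carrier → Set (c ⊔ ℓ₁ ⊔ ℓ₂)
    IsOpt T = (∃ λ ρ → IsSolution ρ × IsLifetime ρ T)
            × (∀ ρ T′ → IsSolution ρ → IsLifetime ρ T′ → T′ ≤ T)

    r : Fin n → Carrier
    r i = max (x i) (1# - x i)

    turnLength : Fin n → Carrier
    turnLength i = fromℚ (b i) * r i ⁻¹

    RR : Carrier
    RR = sum turnLength

    turnStart : Fin n → Carrier
    turnStart i = sum λ (j : Fin (toℕ i)) → turnLength (inject {i = i} j)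

    turnEnd : Fin n → Carrier
    turnEnd i = turnStart i + turnLength i

    -- Turns are the intervals (turnStart i, turnEnd i], so that at most one
    -- sensor is active at any time; the first turn also contains time 0.
    Active : Fin n → Carrier → Set ℓ₂
    Active i t = (toℕ i ≡ 0 ⊎ turnStart i < t) × t ≤ turnEnd i

    active? : ∀ i t → Dec (Active i t)
    active? i t = (toℕ i ℕₚ.≟ 0 ⊎-dec ¬? (t ≤? turnStart i)) ×-dec (t ≤? turnEnd i)

    roundRobin : Radii
    roundRobin i t = if does (active? i t) then r i else 0#

    record IsApproximation (α : ℚ) (ρ : Radii) : Set (c ⊔ ℓ₁ ⊔ ℓ₂) where
      field
        isSolution : IsSolution ρ
        lifetime   : Carrier
        isLifetime : IsLifetime ρ lifetime
        ratio      : ∀ ρ′ T → IsSolution ρ′ → CoveredUntil ρ′ T →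
                     T ≤ fromℚ α * lifetime

{-# OPTIONS --safe #-}

-- Let r x = max x (1 - x).  There is a measure of total mass ⅔ on [0, 1] for
-- which every interval [x - ρ, x + ρ] with x ∈ [0, 1] has mass at most ρ / r x.
-- Its distribution function Φ is, up to additive constants, 2 / (2 - y) for
-- y ≤ ½ and -2 / (1 + y) for y ≥ ½; the bound is attained by [0, 2x] for x ≤ ¼.
-- Hence Σᵢ ρᵢ / r xᵢ ≥ ⅔ whenever [0, 1] is covered, and integrating over time
-- gives ⅔ T ≤ Σᵢ bᵢ / r xᵢ = RR for every solution that covers up to time T.
module Submission where

open import Defs
open import Algebra.Solver.Ring.AlmostCommutativeRing
  using (fromCommutativeRing; _-Raw-AlmostCommutative⟶_)
open import Data.Bool.Base using (true; false; if_then_else_)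
open import Data.Fin.Base as Fin using (Fin; zero; suc; toℕ; inject; punchIn; punchOut)
open import Data.Fin.Properties using (punchIn-punchOut; toℕ-fromℕ<)
open import Data.Integer.Base as ℤ using (ℤ; +_; -[1+_]; 0ℤ; 1ℤ)
open import Data.Maybe.Base using (Maybe; just; nothing)
open import Data.Nat.Base as ℕ using (ℕ; NonZero)
open import Data.Product using (_×_; ∃; _,_; proj₁; proj₂)
open import Data.Rational.Base as ℚ using (0ℚ; _/_)
open import Data.Sum.Base using (_⊎_; inj₁; inj₂)
open import Data.Vec.Functional using (removeAt)
open import Function.Base using (_∘_)
open import Relation.Binary.Bundles using (DecTotalOrder)
open import Relation.Binary.PropositionalEquality.Core as ≡ using (_≡_; _≢_)
open import Relation.Nullary.Decidable using (Dec; yes; no; does; dec-true; dec-false)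
open import Relation.Nullary.Negation using (¬_; contradiction)
import Algebra.Construct.NaturalChoice.Max as Max
import Algebra.Properties.AbelianGroup as AbelianGroupProperties
import Algebra.Properties.Monoid.Sum as MonoidSum
import Algebra.Properties.CommutativeMonoid.Sum as CommutativeMonoidSum
import Algebra.Properties.Ring as RingProperties
import Algebra.Properties.Semiring.Mult.TCOptimised as Mult
import Algebra.Solver.Ring as RingSolver
import Data.Integer.Properties as ℤₚ
import Data.Nat.Properties as ℕₚ

-- Minimising the cost Σᵢ ρᵢ / r xᵢ of a cover of [0, 1] is a linear program in the radii relaxed to
-- coverage constraints, and a measure whose mass on each interval is at most its cost is a dual
-- solution: its total mass bounds every cover from below. The measure therefore appears only
-- through increments of `Φ`, a finite cover is dismantled interval by interval, and monotonicity or
-- convexity is certified by polynomial identities that write a difference as a sum of products of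
-- nonnegative terms. The delicate intervals are those that straddle ½, where `Φ` changes its
-- formula. Convexity of `g` keeps `Φ` below the continuation of its left branch and above that of
-- its right branch. Hence a single branch, chosen by the side of ½ on which the centre lies,
-- controls the whole interval.

module OrderedFieldProperties {c ℓ₁ ℓ₂} (F : OrderedField c ℓ₁ ℓ₂) where
  open OrderedField F hiding (zero)
  open RingProperties ring using (-0#≈0#; -‿involutive; -‿distribˡ-*; -‿distribʳ-*)
  open AbelianGroupProperties +-abelianGroup using () renaming (⁻¹-∙-comm to -‿+-comm)
  open DecTotalOrder decTotalOrder public using ()
    renaming (refl to ≤-refl; trans to ≤-trans; reflexive to ≤-reflexive; total to ≤-total)

  -- Integer coefficients for the ring solver.

  private
    open module M = Mult semiring using () renaming (_×_ to _×′_)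

    -- The optimised multiple `_×′_` sends 0 and 1 to `0#` and `1#` by computation, so the solver's
    -- constants are literally those of the field.
    ⟦_⟧ℤ : ℤ → Carrier
    ⟦ + n ⟧ℤ      = n ×′ 1#
    ⟦ -[1+ n ] ⟧ℤ = - (ℕ.suc n ×′ 1#)

    open import Relation.Binary.Reasoning.Setoid setoid

    ⊖-homo : ∀ m n → ⟦ m ℤ.⊖ n ⟧ℤ ≈ m ×′ 1# - n ×′ 1#
    ⊖-homo m         ℕ.zero    = sym (trans (+-congˡ -0#≈0#) (+-identityʳ _))
    ⊖-homo ℕ.zero    (ℕ.suc n) = sym (+-identityˡ _)
    ⊖-homo (ℕ.suc m) (ℕ.suc n) = begin
      ⟦ ℕ.suc m ℤ.⊖ ℕ.suc n ⟧ℤ              ≡⟨ ≡.cong ⟦_⟧ℤ (ℤₚ.[1+m]⊖[1+n]≡m⊖n m n) ⟩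
      ⟦ m ℤ.⊖ n ⟧ℤ                          ≈⟨ ⊖-homo m n ⟩
      m ×′ 1# - n ×′ 1#                     ≈⟨ +-congʳ (+-identityˡ _) ⟨
      (0# + m ×′ 1#) - n ×′ 1#              ≈⟨ +-congʳ (+-congʳ (-‿inverseʳ 1#)) ⟨
      ((1# - 1#) + m ×′ 1#) - n ×′ 1#       ≈⟨ +-congʳ (+-assoc _ _ _) ⟩
      (1# + (- 1# + m ×′ 1#)) - n ×′ 1#     ≈⟨ +-congʳ (+-congˡ (+-comm _ _)) ⟩
      (1# + (m ×′ 1# - 1#)) - n ×′ 1#       ≈⟨ +-congʳ (+-assoc _ _ _) ⟨
      ((1# + m ×′ 1#) - 1#) - n ×′ 1#       ≈⟨ +-assoc _ _ _ ⟩
      (1# + m ×′ 1#) + (- 1# - n ×′ 1#)     ≈⟨ +-congˡ (-‿+-comm _ _) ⟩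
      (1# + m ×′ 1#) - (1# + n ×′ 1#)       ≈⟨ +-cong (M.1+× m 1#) (-‿cong (M.1+× n 1#)) ⟨
      ℕ.suc m ×′ 1# - ℕ.suc n ×′ 1#         ∎

    +-homo : ∀ i j → ⟦ i ℤ.+ j ⟧ℤ ≈ ⟦ i ⟧ℤ + ⟦ j ⟧ℤ
    +-homo (+ m)    (+ n)    = M.×-homo-+ 1# m n
    +-homo (+ m)    -[1+ n ] = ⊖-homo m (ℕ.suc n)
    +-homo -[1+ m ] (+ n)    = trans (⊖-homo n (ℕ.suc m)) (+-comm _ _)
    +-homo -[1+ m ] -[1+ n ] = begin
      - (ℕ.suc (ℕ.suc (m ℕ.+ n)) ×′ 1#)        ≡⟨ ≡.cong (λ k → - (ℕ.suc k ×′ 1#)) (ℕₚ.+-suc m n) ⟨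
      - ((ℕ.suc m ℕ.+ ℕ.suc n) ×′ 1#)          ≈⟨ -‿cong (M.×-homo-+ 1# (ℕ.suc m) (ℕ.suc n)) ⟩
      - (ℕ.suc m ×′ 1# + ℕ.suc n ×′ 1#)        ≈⟨ -‿+-comm _ _ ⟨
      - (ℕ.suc m ×′ 1#) - (ℕ.suc n ×′ 1#)      ∎

    -‿homo : ∀ i → ⟦ ℤ.- i ⟧ℤ ≈ - ⟦ i ⟧ℤ
    -‿homo (+ ℕ.zero)    = sym -0#≈0#
    -‿homo (+ (ℕ.suc n)) = refl
    -‿homo -[1+ n ]      = sym (-‿involutive _)

    *-homo⁺ : ∀ m j → ⟦ + m ℤ.* j ⟧ℤ ≈ ⟦ + m ⟧ℤ * ⟦ j ⟧ℤ
    *-homo⁺ m (+ n) = trans (reflexive (≡.cong ⟦_⟧ℤ (≡.sym (ℤₚ.pos-* m n)))) (M.×1-homo-* m n)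
    *-homo⁺ m -[1+ n ] = begin
      ⟦ + m ℤ.* ℤ.- (+ ℕ.suc n) ⟧ℤ      ≡⟨ ≡.cong ⟦_⟧ℤ (≡.sym (ℤₚ.neg-distribʳ-* (+ m) (+ ℕ.suc n))) ⟩
      ⟦ ℤ.- (+ m ℤ.* + ℕ.suc n) ⟧ℤ      ≈⟨ -‿homo (+ m ℤ.* + ℕ.suc n) ⟩
      - ⟦ + m ℤ.* + ℕ.suc n ⟧ℤ          ≈⟨ -‿cong (*-homo⁺ m (+ ℕ.suc n)) ⟩
      - (m ×′ 1# * ℕ.suc n ×′ 1#)       ≈⟨ -‿distribʳ-* _ _ ⟩
      m ×′ 1# * - (ℕ.suc n ×′ 1#)       ∎

    *-homo : ∀ i j → ⟦ i ℤ.* j ⟧ℤ ≈ ⟦ i ⟧ℤ * ⟦ j ⟧ℤ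
    *-homo (+ m)    j = *-homo⁺ m j
    *-homo -[1+ m ] j = begin
      ⟦ ℤ.- (+ ℕ.suc m) ℤ.* j ⟧ℤ    ≡⟨ ≡.cong ⟦_⟧ℤ (≡.sym (ℤₚ.neg-distribˡ-* (+ ℕ.suc m) j)) ⟩
      ⟦ ℤ.- (+ ℕ.suc m ℤ.* j) ⟧ℤ    ≈⟨ -‿homo (+ ℕ.suc m ℤ.* j) ⟩
      - ⟦ + ℕ.suc m ℤ.* j ⟧ℤ        ≈⟨ -‿cong (*-homo⁺ (ℕ.suc m) j) ⟩
      - (ℕ.suc m ×′ 1# * ⟦ j ⟧ℤ)    ≈⟨ -‿distribˡ-* _ _ ⟩
      - (ℕ.suc m ×′ 1#) * ⟦ j ⟧ℤ    ∎

    homomorphism : ℤ.+-*-rawRing -Raw-AlmostCommutative⟶ fromCommutativeRing commutativeRing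
    homomorphism = record
      { ⟦_⟧    = ⟦_⟧ℤ
      ; +-homo = +-homo
      ; *-homo = *-homo
      ; -‿homo = -‿homo
      ; 0-homo = refl
      ; 1-homo = refl
      }

    coefficient≟ : ∀ i j → Maybe (⟦ i ⟧ℤ ≈ ⟦ j ⟧ℤ)
    coefficient≟ i j with i ℤₚ.≟ j
    ... | yes i≡j = just (reflexive (≡.cong ⟦_⟧ℤ i≡j))
    ... | no  _   = nothing

  module Solver = RingSolver ℤ.+-*-rawRing (fromCommutativeRing commutativeRing)
                    homomorphism coefficient≟
  open Solver

  -- Shaped like the unfolding of `fromℤ (+ 2)` to `1# + (1# + 0#)`, so that solved identities
  -- mention `2#` and `3#` as they stand.
  two three : ∀ {n} → Polynomial n
  two   = con 1ℤ :+ (con 1ℤ :+ con 0ℤ)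
  three = con 1ℤ :+ two

  -- Lets the ring solver prove an identity modulo a hypothesis m ≈ n, given
  -- its cofactor k.
  modulo : ∀ {x y k m n} → m ≈ n → x ≈ y + k * (m - n) → x ≈ y
  modulo {y = y} {k} {m} {n} m≈n x≈ = trans x≈
    (trans (+-congˡ (trans (*-congˡ (trans (+-congʳ m≈n) (-‿inverseʳ n))) (zeroʳ k)))
           (+-identityʳ y))

  -- The format of nearly all certificates below: `d` is visibly nonnegative, and the identity is
  -- left to the solver, up to multiples of the equations that define reciprocals.
  ≤-by-difference : ∀ {x y d} → 0# ≤ d → y - x ≈ d → x ≤ y
  ≤-by-difference {x} {y} {d} 0≤d y-x≈d =
    ≤-trans (≤-reflexive (sym (+-identityʳ x)))
      (≤-trans (+-monoʳ-≤ x 0≤d)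
        (≤-reflexive (trans (+-congˡ (sym y-x≈d))
          (solve 2 (λ x y → x :+ (y :- x) := y) refl x y))))

  difference-nonneg : ∀ {x y} → x ≤ y → 0# ≤ y - x
  difference-nonneg {x} {y} x≤y =
    ≤-trans (≤-reflexive (sym (-‿inverseˡ x)))
      (≤-trans (+-monoʳ-≤ (- x) x≤y) (≤-reflexive (+-comm (- x) y)))

  +-nonneg : ∀ {x y} → 0# ≤ x → 0# ≤ y → 0# ≤ x + y
  +-nonneg {x} 0≤x 0≤y =
    ≤-trans 0≤x (≤-trans (≤-reflexive (sym (+-identityʳ x))) (+-monoʳ-≤ x 0≤y))

  +-mono-≤ : ∀ {x y u v} → x ≤ y → u ≤ v → x + u ≤ y + v
  +-mono-≤ {x} {y} {u} {v} x≤y u≤v =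
    ≤-by-difference (+-nonneg (difference-nonneg x≤y) (difference-nonneg u≤v))
      (solve 4 (λ x y u v → (y :+ v) :- (x :+ u) := (y :- x) :+ (v :- u)) refl x y u v)

  *-monoˡ-≤ : ∀ {x y z} → 0# ≤ z → x ≤ y → z * x ≤ z * y
  *-monoˡ-≤ {x} {y} {z} 0≤z x≤y =
    ≤-by-difference (*-nonneg 0≤z (difference-nonneg x≤y))
      (solve 3 (λ x y z → z :* y :- z :* x := z :* (y :- x)) refl x y z)

  <⇒≤ : ∀ {x y} → x < y → x ≤ y
  <⇒≤ {x} {y} x<y with ≤-total x y
  ... | inj₁ x≤y = x≤y
  ... | inj₂ y≤x = contradiction y≤x x<y

  ≮⇒≥ : ∀ {x y} → ¬ x < y → y ≤ x
  ≮⇒≥ {x} {y} x≮y with y ≤? x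
  ... | yes y≤x = y≤x
  ... | no  x<y = contradiction x<y x≮y

  ≤-<-trans : ∀ {x y z} → x ≤ y → y < z → x < z
  ≤-<-trans x≤y y<z z≤x = y<z (≤-trans z≤x x≤y)

  <-≤-trans : ∀ {x y z} → x < y → y ≤ z → x < z
  <-≤-trans x<y y≤z z≤x = x<y (≤-trans y≤z z≤x)

  0≤1 : 0# ≤ 1#
  0≤1 with ≤-total 0# 1#
  ... | inj₁ 0≤1 = 0≤1
  ... | inj₂ 1≤0 = ≤-trans (*-nonneg 0≤-1 0≤-1)
      (≤-reflexive (solve 0 ((con 0ℤ :- con 1ℤ) :* (con 0ℤ :- con 1ℤ) := con 1ℤ) refl))
    where
    0≤-1 : 0# ≤ 0# - 1#
    0≤-1 = difference-nonneg 1≤0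

  0<1 : 0# < 1#
  0<1 1≤0 = 0≉1 (antisym 0≤1 1≤0)
    where open DecTotalOrder decTotalOrder using (antisym)

  1≤x⇒0<x : ∀ {x} → 1# ≤ x → 0# < x
  1≤x⇒0<x = <-≤-trans 0<1

  ⁻¹-inverse : ∀ {x} → 0# < x → x * x ⁻¹ ≈ 1#
  ⁻¹-inverse {x} 0<x = ⁻¹-inverseʳ x (λ x≈0 → 0<x (≤-reflexive x≈0))

  ⁻¹-nonneg : ∀ {x} → 0# < x → 0# ≤ x ⁻¹
  ⁻¹-nonneg {x} 0<x with ≤-total 0# (x ⁻¹)
  ... | inj₁ 0≤x⁻¹ = 0≤x⁻¹
  ... | inj₂ x⁻¹≤0 = contradiction
      (≤-trans (*-monoˡ-≤ (<⇒≤ 0<x) x⁻¹≤0) (≤-reflexive (zeroʳ x)))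
      (1≤x⇒0<x (≤-reflexive (sym (⁻¹-inverse 0<x))))

  2# 3# : Carrier
  2# = fromℤ (+ 2)
  3# = fromℤ (+ 3)

  fromℤ⁺-nonneg : ∀ n → 0# ≤ fromℤ (+ n)
  fromℤ⁺-nonneg ℕ.zero    = ≤-refl
  fromℤ⁺-nonneg (ℕ.suc n) = +-nonneg 0≤1 (fromℤ⁺-nonneg n)

  fromℤ⁺-positive : ∀ n → 0# < fromℤ (+ (ℕ.suc n))
  fromℤ⁺-positive n = 1≤x⇒0<x
    (≤-by-difference (fromℤ⁺-nonneg n)
      (solve 1 (λ m → (con 1ℤ :+ m) :- con 1ℤ := m) refl (fromℤ (+ n))))

  fromℚ-nonneg : ∀ q → 0ℚ ℚ.≤ q → 0# ≤ fromℚ q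
  fromℚ-nonneg (ℚ.mkℚ (+ n) d _) _ =
    *-nonneg (fromℤ⁺-nonneg n) (⁻¹-nonneg (fromℤ⁺-positive d))
  fromℚ-nonneg (ℚ.mkℚ -[1+ n ] d _) (ℚ.*≤* ())

  ½ ⅓ : Carrier
  ½ = 2# ⁻¹
  ⅓ = 3# ⁻¹

  2*½≈1 : 2# * ½ ≈ 1#
  2*½≈1 = ⁻¹-inverse (fromℤ⁺-positive 1)

  3*⅓≈1 : 3# * ⅓ ≈ 1#
  3*⅓≈1 = ⁻¹-inverse (fromℤ⁺-positive 2)

  0≤½ : 0# ≤ ½
  0≤½ = ⁻¹-nonneg (fromℤ⁺-positive 1)

  0≤⅓ : 0# ≤ ⅓
  0≤⅓ = ⁻¹-nonneg (fromℤ⁺-positive 2)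

  <-dense : ∀ {x y} → x < y → ∃ λ m → x < m × m < y
  <-dense {x} {y} x<y = (x + y) * ½ , x<m , m<y
    where
    x<m : x < (x + y) * ½
    x<m m≤x = x<y (≤-by-difference
      (*-nonneg (fromℤ⁺-nonneg 2) (difference-nonneg m≤x))
      (modulo 2*½≈1 (solve 3 (λ x y h →
        x :- y := two :* (x :- (x :+ y) :* h) :+ (x :+ y) :* (two :* h :- con 1ℤ)) refl x y ½)))
    m<y : (x + y) * ½ < y
    m<y y≤m = x<y (≤-by-difference
      (*-nonneg (fromℤ⁺-nonneg 2) (difference-nonneg y≤m))
      (modulo 2*½≈1 (solve 3 (λ x y h →
        x :- y := two :* ((x :+ y) :* h :- y) :+ (:- (x :+ y)) :* (two :* h :- con 1ℤ)) refl x y ½)))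

  square-nonneg : ∀ x → 0# ≤ x * x
  square-nonneg x with ≤-total 0# x
  ... | inj₁ 0≤x = *-nonneg 0≤x 0≤x
  ... | inj₂ x≤0 = ≤-trans (*-nonneg (difference-nonneg x≤0) (difference-nonneg x≤0))
    (≤-reflexive (solve 1 (λ x → (con 0ℤ :- x) :* (con 0ℤ :- x) := x :* x) refl x))

  -- Finite sums and covers by finitely many intervals.

  open MonoidSum +-monoid using (sum-replicate-zero; sum-cong-≋)
  open CommutativeMonoidSum +-commutativeMonoid using (sum-remove)

  sum-mono-≤ : ∀ {n} {f g : Fin n → Carrier} → (∀ i → f i ≤ g i) → sum f ≤ sum g
  sum-mono-≤ {ℕ.zero}  f≤g = ≤-refl
  sum-mono-≤ {ℕ.suc n} f≤g = +-mono-≤ (f≤g zero) (sum-mono-≤ (f≤g ∘ suc))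

  sum-zero : ∀ {n} {f : Fin n → Carrier} → (∀ i → f i ≈ 0#) → sum f ≈ 0#
  sum-zero {n} f≈0 = trans (sum-cong-≋ f≈0) (sum-replicate-zero n)

  sum-nonneg : ∀ {n} {f : Fin n → Carrier} → (∀ i → 0# ≤ f i) → 0# ≤ sum f
  sum-nonneg {n} 0≤f = ≤-trans (≤-reflexive (sym (sum-replicate-zero n))) (sum-mono-≤ 0≤f)

  -- A substitute for compactness: with `r` the right ends of a cover, an interval that contains `y`
  -- cannot end before `b`. Midpoints push `y` past each right end below `b` in turn.
  exceedingAllBelow : ∀ {n} (r : Fin n → Carrier) {a b} → a < b →
    ∃ λ y → a ≤ y × y < b × (∀ i → r i < b → r i < y)
  exceedingAllBelow {ℕ.zero} r {a} a<b = a , ≤-refl , a<b , λ ()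
  exceedingAllBelow {ℕ.suc n} r {a} {b} a<b with exceedingAllBelow (r ∘ suc) a<b | b ≤? r zero
  ... | y , a≤y , y<b , r<y | yes b≤r₀ =
    y , a≤y , y<b , λ { zero r₀<b → contradiction b≤r₀ r₀<b ; (suc i) → r<y i }
  ... | y , a≤y , y<b , r<y | no r₀<b with ≤-total y (r zero)
  ... | inj₁ y≤r₀ with <-dense r₀<b
  ...   | m , r₀<m , m<b = m , ≤-trans a≤y y≤m , m<b ,
          λ { zero _ → r₀<m ; (suc i) rᵢ<b → <-≤-trans (r<y i rᵢ<b) y≤m }
    where
    y≤m : y ≤ m
    y≤m = ≤-trans y≤r₀ (<⇒≤ r₀<m)
  exceedingAllBelow {ℕ.suc n} r {a} {b} a<b | y , a≤y , y<b , r<y | no r₀<b | inj₂ r₀≤y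
    with <-dense y<b
  ...   | m , y<m , m<b = m , ≤-trans a≤y (<⇒≤ y<m) , m<b ,
          λ { zero _ → ≤-<-trans r₀≤y y<m ; (suc i) rᵢ<b → <-≤-trans (r<y i rᵢ<b) (<⇒≤ y<m) }

  -- Induction on the number of intervals: one of them reaches b from the left,
  -- and the others cover everything to its left.
  cover-bound : ∀ (Φ : Carrier → Carrier) {n} (l r c : Fin n → Carrier) →
    (∀ i → 0# ≤ c i) →
    (∀ i {u v} → 0# ≤ u → u ≤ v → v ≤ 1# → l i ≤ u → v ≤ r i → Φ v - Φ u ≤ c i) →
    ∀ {b} → 0# < b → b ≤ 1# →
    (∀ y → 0# ≤ y → y < b → ∃ λ i → l i ≤ y × y ≤ r i) →
    Φ b - Φ 0# ≤ sum c
  cover-bound Φ {ℕ.zero} l r c 0≤c Φ≤c 0<b b≤1 covered with covered 0# ≤-refl 0<b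
  ... | () , _
  cover-bound Φ {ℕ.suc n} l r c 0≤c Φ≤c {b} 0<b b≤1 covered
    with exceedingAllBelow r 0<b
  ... | y , 0≤y , y<b , r<y with covered y 0≤y y<b
  ... | i , lᵢ≤y , y≤rᵢ = ≤-trans bound (≤-reflexive (sym (sum-remove {i = i} c)))
    where
    b≤rᵢ : b ≤ r i
    b≤rᵢ = ≮⇒≥ λ rᵢ<b → r<y i rᵢ<b y≤rᵢ
    lᵢ≤b : l i ≤ b
    lᵢ≤b = ≤-trans lᵢ≤y (<⇒≤ y<b)
    bound : Φ b - Φ 0# ≤ c i + sum (removeAt c i)
    bound with l i ≤? 0#
    ... | yes lᵢ≤0 = ≤-trans (≤-reflexive (sym (+-identityʳ _)))
      (+-mono-≤ (Φ≤c i ≤-refl (<⇒≤ 0<b) b≤1 lᵢ≤0 b≤rᵢ) (sum-nonneg (0≤c ∘ punchIn i)))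
    ... | no 0<lᵢ = ≤-trans
      (≤-reflexive (solve 3 (λ x y z → x :- z := (x :- y) :+ (y :- z)) refl (Φ b) (Φ (l i)) (Φ 0#)))
      (+-mono-≤ (Φ≤c i (<⇒≤ 0<lᵢ) lᵢ≤b b≤1 ≤-refl b≤rᵢ)
        (cover-bound Φ (removeAt l i) (removeAt r i) (removeAt c i)
          (0≤c ∘ punchIn i) (Φ≤c ∘ punchIn i) 0<lᵢ (≤-trans lᵢ≤b b≤1) others))
      where
      -- Strictness of `z < l i` puts `z` outside interval `i`. Coverage is asked only strictly
      -- below `b` so that this half-open form is inherited by the remaining intervals.
      others : ∀ z → 0# ≤ z → z < l i → ∃ λ j → removeAt l i j ≤ z × z ≤ removeAt r i j
      others z 0≤z z<lᵢ with covered z 0≤z (<-≤-trans z<lᵢ lᵢ≤b)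
      ... | j , lⱼ≤z , z≤rⱼ =
        punchOut i≢j , ≡.subst (λ k → l k ≤ z × z ≤ r k) (≡.sym (punchIn-punchOut i≢j)) (lⱼ≤z , z≤rⱼ)
        where
        i≢j : i ≢ j
        i≢j ≡.refl = z<lᵢ lⱼ≤z

-- The dual measure and its mass on intervals.

module Potential {c ℓ₁ ℓ₂} (F : OrderedField c ℓ₁ ℓ₂) where
  open OrderedField F hiding (zero)
  open OrderedFieldProperties F
  open Solver
  open Max totalOrder using (x≤x⊔y; x≤y⊔x; x≤y⇒x⊔y≈y; x≤y⇒y⊔x≈y)

  -- `2# * ⅓` is also what `fromℚ (+ 2 / 3)` computes to, so bounds with `⅔` apply to the theorem
  -- without conversion.
  ⅔ 4/3 : Carrier
  ⅔   = 2# * ⅓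
  4/3 = 2# * ⅔

  -- Equality on [0, 2x] demands g (2x) - g 0 = x / (1 - x) = 1 / (1 - x) - 1; substituting y = 2x
  -- gives 2 / (2 - y).
  g : Carrier → Carrier
  g y = 2# * (2# - y) ⁻¹

  -- Since g ½ = 4/3, both branches vanish at ½, and the right branch is the negated mirror image of
  -- the left one.
  Φ : Carrier → Carrier
  Φ y with y ≤? ½
  ... | yes _ = g y - 4/3
  ... | no  _ = 4/3 - g (1# - y)

  2-y>0 : ∀ {y} → y ≤ 1# → 0# < 2# - y
  2-y>0 {y} y≤1 = 1≤x⇒0<x (≤-by-difference (difference-nonneg y≤1)
    (solve 1 (λ y → (two :- y) :- con 1ℤ := con 1ℤ :- y) refl y))

  ½≤1 : ½ ≤ 1#
  ½≤1 = ≤-by-difference 0≤½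
    (modulo 2*½≈1 (solve 1 (λ h → con 1ℤ :- h := h :+ (:- con 1ℤ) :* (two :* h :- con 1ℤ)) refl ½))

  1-y≤1 : ∀ {y} → 0# ≤ y → 1# - y ≤ 1#
  1-y≤1 {y} 0≤y = ≤-by-difference 0≤y (solve 1 (λ y → con 1ℤ :- (con 1ℤ :- y) := y) refl y)

  ½≤y⇒1-y≤½ : ∀ {y} → ½ ≤ y → 1# - y ≤ ½
  ½≤y⇒1-y≤½ {y} ½≤y = ≤-by-difference (difference-nonneg ½≤y)
    (modulo 2*½≈1 (solve 2 (λ y h → h :- (con 1ℤ :- y) := (y :- h) :+ con 1ℤ :* (two :* h :- con 1ℤ)) refl y ½))

  y≤½⇒½≤1-y : ∀ {y} → y ≤ ½ → ½ ≤ 1# - y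
  y≤½⇒½≤1-y {y} y≤½ = ≤-by-difference (difference-nonneg y≤½)
    (modulo 2*½≈1 (solve 2 (λ y h → (con 1ℤ :- y) :- h := (h :- y) :+ (:- con 1ℤ) :* (two :* h :- con 1ℤ)) refl y ½))

  g≤4/3 : ∀ {y} → y ≤ ½ → g y ≤ 4/3
  g≤4/3 {y} y≤½ = ≤-by-difference
    (*-nonneg (*-nonneg (⁻¹-nonneg 0<2-y) 0≤⅓)
      (*-nonneg (fromℤ⁺-nonneg 4) (difference-nonneg y≤½)))
    (modulo (⁻¹-inverse 0<2-y) (modulo 3*⅓≈1 (modulo 2*½≈1
      (solve 4 (λ y P τ h →
        two :* (two :* τ) :- two :* P :=
          ((P :* τ :* ((con 1ℤ :+ three) :* (h :- y))
            :+ (:- (two :* τ :* two)) :* ((two :- y) :* P :- con 1ℤ))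
            :+ (two :* P) :* (three :* τ :- con 1ℤ))
            :+ (:- (two :* P :* τ)) :* (two :* h :- con 1ℤ))
        refl y _ ⅓ ½))))
    where
    0<2-y : 0# < 2# - y
    0<2-y = 2-y>0 (≤-trans y≤½ ½≤1)

  4/3≤g : ∀ {y} → ½ ≤ y → y ≤ 1# → 4/3 ≤ g y
  4/3≤g {y} ½≤y y≤1 = ≤-by-difference
    (*-nonneg (*-nonneg (⁻¹-nonneg 0<2-y) 0≤⅓)
      (*-nonneg (fromℤ⁺-nonneg 4) (difference-nonneg ½≤y)))
    (modulo (⁻¹-inverse 0<2-y) (modulo 3*⅓≈1 (modulo 2*½≈1
      (solve 4 (λ y P τ h →
        two :* P :- two :* (two :* τ) :=
          ((P :* τ :* ((con 1ℤ :+ three) :* (y :- h))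
            :+ (two :* τ :* two) :* ((two :- y) :* P :- con 1ℤ))
            :+ (:- (two :* P)) :* (three :* τ :- con 1ℤ))
            :+ (two :* P :* τ) :* (two :* h :- con 1ℤ))
        refl y _ ⅓ ½))))
    where
    0<2-y : 0# < 2# - y
    0<2-y = 2-y>0 y≤1

  -- Jensen's inequality for the convex function g, at the midpoint ½ of y and 1 - y.
  8/3≤g+g : ∀ {y} → 0# ≤ y → y ≤ 1# → 4/3 - g (1# - y) ≤ g y - 4/3
  8/3≤g+g {y} 0≤y y≤1 = ≤-by-difference
    (*-nonneg (*-nonneg (⁻¹-nonneg 0<A) (⁻¹-nonneg 0<B))
      (*-nonneg (*-nonneg (fromℤ⁺-nonneg 2) 0≤⅓) (square-nonneg (2# * y - 1#))))
    (modulo (⁻¹-inverse 0<A) (modulo (⁻¹-inverse 0<B) (modulo 3*⅓≈1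
      (solve 4 (λ y P Q τ →
        (two :* P :- two :* (two :* τ)) :- (two :* (two :* τ) :- two :* Q) :=
          ((P :* Q :* (two :* τ :* ((two :* y :- con 1ℤ) :* (two :* y :- con 1ℤ)))
            :+ (two :* (two :* two :* τ :* ((two :- (con 1ℤ :- y)) :* Q) :- Q)) :* ((two :- y) :* P :- con 1ℤ))
            :+ (two :* (two :* two :* τ :- P)) :* ((two :- (con 1ℤ :- y)) :* Q :- con 1ℤ))
            :+ (:- (two :* three :* P :* Q)) :* (three :* τ :- con 1ℤ))
        refl y _ _ ⅓))))
    where
    0<A : 0# < 2# - y
    0<A = 2-y>0 y≤1
    0<B : 0# < 2# - (1# - y)
    0<B = 2-y>0 (1-y≤1 0≤y)

  x≤y⇒x-y≤0 : ∀ {x y} → x ≤ y → x - y ≤ 0#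
  x≤y⇒x-y≤0 {x} {y} x≤y = ≤-by-difference (difference-nonneg x≤y)
    (solve 2 (λ x y → con 0ℤ :- (x :- y) := y :- x) refl x y)

  -- By convexity of `g` the left branch dominates the right one on all of [0, 1]. As `Φ` always
  -- equals one of them, it lies between the two continuations.
  Φ≤left : ∀ {y} → 0# ≤ y → y ≤ 1# → Φ y ≤ g y - 4/3
  Φ≤left {y} 0≤y y≤1 with y ≤? ½
  ... | yes _ = ≤-refl
  ... | no  _ = 8/3≤g+g 0≤y y≤1

  right≤Φ : ∀ {y} → 0# ≤ y → y ≤ 1# → 4/3 - g (1# - y) ≤ Φ y
  right≤Φ {y} 0≤y y≤1 with y ≤? ½
  ... | yes _ = 8/3≤g+g 0≤y y≤1
  ... | no  _ = ≤-refl

  left≤Φ : ∀ {y} → y ≤ ½ → g y - 4/3 ≤ Φ y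
  left≤Φ {y} y≤½ with y ≤? ½
  ... | yes _  = ≤-refl
  ... | no ½<y = contradiction y≤½ ½<y

  0≤Φ : ∀ {y} → ½ ≤ y → y ≤ 1# → 0# ≤ Φ y
  0≤Φ {y} ½≤y y≤1 with y ≤? ½
  ... | yes _ = difference-nonneg (4/3≤g ½≤y y≤1)
  ... | no  _ = difference-nonneg (g≤4/3 (½≤y⇒1-y≤½ ½≤y))

  Φ≤0 : ∀ {y} → y ≤ ½ → Φ y ≤ 0#
  Φ≤0 {y} y≤½ with y ≤? ½
  ... | yes _  = x≤y⇒x-y≤0 (g≤4/3 y≤½)
  ... | no ½<y = contradiction y≤½ ½<y

  Φ≤right : ∀ {y} → ½ ≤ y → Φ y ≤ 4/3 - g (1# - y)
  Φ≤right {y} ½≤y with y ≤? ½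
  ... | yes y≤½ = ≤-trans (x≤y⇒x-y≤0 (g≤4/3 y≤½)) (difference-nonneg (g≤4/3 (½≤y⇒1-y≤½ ½≤y)))
  ... | no  _   = ≤-refl

  -- The values are 1/3 at 1 and -1/3 at 0. Bounding `Φ` between its branches gives each in the
  -- required direction without evaluating the test inside `Φ`.
  ⅔≤Φ1-Φ0 : ⅔ ≤ Φ 1# - Φ 0#
  ⅔≤Φ1-Φ0 = ≤-by-difference
    (+-nonneg (difference-nonneg (right≤Φ 0≤1 ≤-refl)) (difference-nonneg (Φ≤left ≤-refl 0≤1)))
    (modulo 3*⅓≈1 (modulo e₀ (modulo e₁
      (solve 5 (λ a b P Q τ → (a :- b) :- two :* τ :=
        ((((a :- (two :* (two :* τ) :- two :* Q)) :+ ((two :* P :- two :* (two :* τ)) :- b))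
          :+ two :* (three :* τ :- con 1ℤ))
          :+ (:- con 1ℤ) :* ((two :- con 0ℤ) :* P :- con 1ℤ))
          :+ (:- con 1ℤ) :* ((two :- (con 1ℤ :- con 1ℤ)) :* Q :- con 1ℤ))
        refl (Φ 1#) (Φ 0#) _ _ ⅓))))
    where
    e₀ : (2# - 0#) * (2# - 0#) ⁻¹ ≈ 1#
    e₀ = ⁻¹-inverse (2-y>0 0≤1)
    e₁ : (2# - (1# - 1#)) * (2# - (1# - 1#)) ⁻¹ ≈ 1#
    e₁ = ⁻¹-inverse (2-y>0 (1-y≤1 0≤1))

  -- Here R = 1 - x for an interval with centre x and radius ρ.
  g-increment : ∀ {R ρ u v} → 0# < R → R ≤ 1# → 0# ≤ ρ → 0# ≤ u → u ≤ v → v ≤ 1# →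
    1# - R - ρ ≤ u → v ≤ 1# - R + ρ → g v - g u ≤ ρ * R ⁻¹
  g-increment {R} {ρ} {u} {v} 0<R R≤1 0≤ρ 0≤u u≤v v≤1 l≤u v≤r with R ≤? ρ
  -- The cost is at least 1, while `g` grows from 1 to 2 on [0, 1]. The three summands are ρ / R -
  -- 1, 2 - g v and g u - 1.
  ... | yes R≤ρ = ≤-by-difference
      (+-nonneg (+-nonneg (*-nonneg (difference-nonneg R≤ρ) (⁻¹-nonneg 0<R))
        (*-nonneg (*-nonneg (fromℤ⁺-nonneg 2) (⁻¹-nonneg (2-y>0 v≤1))) (difference-nonneg v≤1)))
        (*-nonneg (⁻¹-nonneg (2-y>0 u≤1)) 0≤u))
      (modulo (⁻¹-inverse 0<R) (modulo (⁻¹-inverse (2-y>0 v≤1)) (modulo (⁻¹-inverse (2-y>0 u≤1))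
        (solve 7 (λ R ρ u v P Q s → ρ :* s :- (two :* P :- two :* Q) :=
          (((((ρ :- R) :* s :+ two :* P :* (con 1ℤ :- v)) :+ Q :* u)
          :+ con 1ℤ :* (R :* s :- con 1ℤ))
          :+ (:- two) :* ((two :- v) :* P :- con 1ℤ))
          :+ con 1ℤ :* ((two :- u) :* Q :- con 1ℤ))
          refl R ρ u v _ _ _))))
    where
    u≤1 : u ≤ 1#
    u≤1 = ≤-trans u≤v v≤1
  -- Over the common denominator (2 - v) (2 - u) R the difference has numerator `D`.
  ... | no ρ<R = ≤-by-difference
      (*-nonneg (*-nonneg (*-nonneg (⁻¹-nonneg 0<A) (⁻¹-nonneg 0<B)) (⁻¹-nonneg 0<R)) 0≤D)
      (modulo (⁻¹-inverse 0<A) (modulo (⁻¹-inverse 0<B) (modulo (⁻¹-inverse 0<R)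
        (solve 7 (λ R ρ A B P Q s → ρ :* s :- (two :* P :- two :* Q) :=
          ((P :* Q :* s :* (ρ :* A :* B :+ two :* A :* R :- two :* B :* R)
          :+ (:- (ρ :* s :* B :* Q :+ two :* Q :* R :* s)) :* (A :* P :- con 1ℤ))
          :+ (two :* P :* R :* s :- ρ :* s) :* (B :* Q :- con 1ℤ))
          :+ (two :* P :- two :* Q) :* (R :* s :- con 1ℤ))
          refl R ρ (2# - v) (2# - u) _ _ _))))
    where
    0<A : 0# < 2# - v
    0<A = 2-y>0 v≤1
    0<B : 0# < 2# - u
    0<B = 2-y>0 (≤-trans u≤v v≤1)
    D : Carrier
    D = ρ * (2# - v) * (2# - u) + 2# * (2# - v) * R - 2# * (2# - u) * R
    0≤R-ρ : 0# ≤ R - ρ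
    0≤R-ρ = difference-nonneg (<⇒≤ ρ<R)
    -- D decreases in v and increases in u, so it is smallest for the whole interval.
    0≤slopeᵥ : 0# ≤ (1# - R + ρ - v) * (ρ * (2# - u) + 2# * R)
    0≤slopeᵥ = *-nonneg (difference-nonneg v≤r)
      (+-nonneg (*-nonneg 0≤ρ (<⇒≤ 0<B)) (*-nonneg (fromℤ⁺-nonneg 2) (<⇒≤ 0<R)))
    0≤slopeᵤ : 0# ≤ 2# * (R - ρ) + ρ * (1# - R + ρ)
    0≤slopeᵤ = +-nonneg (*-nonneg (fromℤ⁺-nonneg 2) 0≤R-ρ)
      (*-nonneg 0≤ρ (+-nonneg (difference-nonneg R≤1) 0≤ρ))
    0≤D : 0# ≤ D
    0≤D with ρ ≤? 1# - R
    -- At u = x - ρ and v = x + ρ the value of `D` is ρ (x - ρ) (x + ρ).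
    ... | yes ρ≤x = ≤-trans
      (+-nonneg (+-nonneg 0≤slopeᵥ (*-nonneg (difference-nonneg l≤u) 0≤slopeᵤ))
        (*-nonneg (*-nonneg 0≤ρ (difference-nonneg ρ≤x)) (+-nonneg (difference-nonneg R≤1) 0≤ρ)))
      (≤-reflexive (solve 4 (λ R ρ u v →
        ((con 1ℤ :- R :+ ρ :- v) :* (ρ :* (two :- u) :+ two :* R)
        :+ (u :- (con 1ℤ :- R :- ρ)) :* (two :* (R :- ρ) :+ ρ :* (con 1ℤ :- R :+ ρ)))
        :+ (ρ :* (con 1ℤ :- R :- ρ)) :* (con 1ℤ :- R :+ ρ)
        := ρ :* (two :- v) :* (two :- u) :+ two :* (two :- v) :* R :- two :* (two :- u) :* R)
        refl R ρ u v))
    -- The interval is cut off at u = 0, where with v = x + ρ the value of `D` is 2 (ρ - x) (R - ρ).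
    -- Both corner values vanish at ρ = x, the tight case.
    ... | no x<ρ = ≤-trans
      (+-nonneg (+-nonneg 0≤slopeᵥ (*-nonneg 0≤u 0≤slopeᵤ))
        (*-nonneg (*-nonneg (fromℤ⁺-nonneg 2) (difference-nonneg (<⇒≤ x<ρ))) 0≤R-ρ))
      (≤-reflexive (solve 4 (λ R ρ u v →
        ((con 1ℤ :- R :+ ρ :- v) :* (ρ :* (two :- u) :+ two :* R)
        :+ u :* (two :* (R :- ρ) :+ ρ :* (con 1ℤ :- R :+ ρ)))
        :+ (two :* (ρ :- (con 1ℤ :- R))) :* (R :- ρ)
        := ρ :* (two :- v) :* (two :- u) :+ two :* (two :- v) :* R :- two :* (two :- u) :* R)
        refl R ρ u v))

  -- Here `k` is the additive constant of a branch of `Φ`, which cancels in increments.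
  ≤-difference-left : ∀ {a b c d k} → a ≤ b - k → c - k ≤ d → a - d ≤ b - c
  ≤-difference-left {a} {b} {c} {d} {k} a≤b-k c-k≤d =
    ≤-by-difference (+-nonneg (difference-nonneg a≤b-k) (difference-nonneg c-k≤d))
      (solve 5 (λ a b c d k → (b :- c) :- (a :- d) := ((b :- k) :- a) :+ (d :- (c :- k)))
        refl a b c d k)

  ≤-difference-right : ∀ {a b c d k} → a ≤ k - c → k - b ≤ d → a - d ≤ b - c
  ≤-difference-right {a} {b} {c} {d} {k} a≤k-c k-b≤d =
    ≤-by-difference (+-nonneg (difference-nonneg a≤k-c) (difference-nonneg k-b≤d))
      (solve 5 (λ a b c d k → (b :- c) :- (a :- d) := ((k :- c) :- a) :+ (d :- (k :- b)))
        refl a b c d k)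

  x≤1-x⇒x≤½ : ∀ {x} → x ≤ 1# - x → x ≤ ½
  x≤1-x⇒x≤½ {x} x≤1-x = ≤-by-difference (*-nonneg 0≤½ (difference-nonneg x≤1-x))
    (modulo 2*½≈1 (solve 2 (λ x h →
      h :- x := h :* ((con 1ℤ :- x) :- x) :+ x :* (two :* h :- con 1ℤ)) refl x ½))

  1-x≤x⇒½≤x : ∀ {x} → 1# - x ≤ x → ½ ≤ x
  1-x≤x⇒½≤x {x} 1-x≤x = ≤-by-difference (*-nonneg 0≤½ (difference-nonneg 1-x≤x))
    (modulo 2*½≈1 (solve 2 (λ x h →
      x :- h := h :* (x :- (con 1ℤ :- x)) :+ (:- x) :* (two :* h :- con 1ℤ)) refl x ½))

  0<½ : 0# < ½
  0<½ ½≤0 = 0<1 (≤-trans (≤-reflexive (sym 2*½≈1))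
    (≤-trans (*-monoˡ-≤ (fromℤ⁺-nonneg 2) ½≤0) (≤-reflexive (zeroʳ 2#))))

  max-x-1-x>0 : ∀ x → 0# < max x (1# - x)
  max-x-1-x>0 x with ≤-total x (1# - x)
  ... | inj₁ x≤1-x = <-≤-trans 0<½ (≤-trans (y≤½⇒½≤1-y (x≤1-x⇒x≤½ x≤1-x)) (x≤y⊔x _ _))
  ... | inj₂ 1-x≤x = <-≤-trans 0<½ (≤-trans (1-x≤x⇒½≤x 1-x≤x) (x≤x⊔y _ _))

  Φ-increment : ∀ {x ρ u v} → 0# ≤ x → x ≤ 1# → 0# ≤ ρ → 0# ≤ u → u ≤ v → v ≤ 1# →
    x - ρ ≤ u → v ≤ x + ρ → Φ v - Φ u ≤ ρ * max x (1# - x) ⁻¹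
  Φ-increment {x} {ρ} {u} {v} 0≤x x≤1 0≤ρ 0≤u u≤v v≤1 l≤u v≤r = bound (≤-total x (1# - x))
    where
    R : Carrier
    R = max x (1# - x)
    0<R : 0# < R
    0<R = max-x-1-x>0 x
    0≤v : 0# ≤ v
    0≤v = ≤-trans 0≤u u≤v
    u≤1 : u ≤ 1#
    u≤1 = ≤-trans u≤v v≤1

    module Left (x≤1-x : x ≤ 1# - x) where
      R≈1-x : R ≈ 1# - x
      R≈1-x = x≤y⇒x⊔y≈y x≤1-x
      R≤1 : R ≤ 1#
      R≤1 = ≤-trans (≤-reflexive R≈1-x) (1-y≤1 0≤x)
      x≤½ : x ≤ ½
      x≤½ = x≤1-x⇒x≤½ x≤1-x
      left-end : 1# - R - ρ ≤ x - ρ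
      left-end = ≤-reflexive (modulo R≈1-x (solve 3 (λ x R ρ →
        con 1ℤ :- R :- ρ := (x :- ρ) :+ (:- con 1ℤ) :* (R :- (con 1ℤ :- x))) refl x R ρ))
      right-end : x + ρ ≤ 1# - R + ρ
      right-end = ≤-reflexive (modulo R≈1-x (solve 3 (λ x R ρ →
        x :+ ρ := (con 1ℤ :- R :+ ρ) :+ con 1ℤ :* (R :- (con 1ℤ :- x))) refl x R ρ))

      left : Φ v - Φ u ≤ ρ * R ⁻¹
      left with ≤-total u ½
      ... | inj₁ u≤½ = ≤-trans
        (≤-difference-left (Φ≤left 0≤v v≤1) (left≤Φ u≤½))
        (g-increment 0<R R≤1 0≤ρ 0≤u u≤v v≤1 (≤-trans left-end l≤u) (≤-trans v≤r right-end))
      -- The left branch no longer bounds `Φ u` from below, so `u` is lowered to ½, where that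
      -- branch is 0 ≤ `Φ u`. As x - ρ ≤ x ≤ ½, the point ½ is not left of the interval.
      ... | inj₂ ½≤u = ≤-trans
        (≤-difference-left (Φ≤left 0≤v v≤1)
          (≤-trans (x≤y⇒x-y≤0 (g≤4/3 ≤-refl)) (0≤Φ ½≤u u≤1)))
        (g-increment 0<R R≤1 0≤ρ 0≤½ (≤-trans ½≤u u≤v) v≤1
          (≤-trans left-end (≤-trans x-ρ≤x x≤½)) (≤-trans v≤r right-end))
        where
        x-ρ≤x : x - ρ ≤ x
        x-ρ≤x = ≤-by-difference 0≤ρ (solve 2 (λ x ρ → x :- (x :- ρ) := ρ) refl x ρ)

    module Right (1-x≤x : 1# - x ≤ x) where
      R≈x : R ≈ x
      R≈x = x≤y⇒y⊔x≈y 1-x≤x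
      R≤1 : R ≤ 1#
      R≤1 = ≤-trans (≤-reflexive R≈x) x≤1
      ½≤x : ½ ≤ x
      ½≤x = 1-x≤x⇒½≤x 1-x≤x
      left-end : 1# - R - ρ ≤ 1# - v
      left-end = ≤-by-difference (difference-nonneg v≤r)
        (modulo R≈x (solve 4 (λ x R ρ v → (con 1ℤ :- v) :- (con 1ℤ :- R :- ρ) :=
          ((x :+ ρ) :- v) :+ con 1ℤ :* (R :- x)) refl x R ρ v))
      right-end : 1# - u ≤ 1# - R + ρ
      right-end = ≤-by-difference (difference-nonneg l≤u)
        (modulo R≈x (solve 4 (λ x R ρ u → (con 1ℤ :- R :+ ρ) :- (con 1ℤ :- u) :=
          (u :- (x :- ρ)) :+ (:- con 1ℤ) :* (R :- x)) refl x R ρ u))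

      right : Φ v - Φ u ≤ ρ * R ⁻¹
      right with ≤-total v ½
      ... | inj₂ ½≤v = ≤-trans
        (≤-difference-right (Φ≤right ½≤v) (right≤Φ 0≤u u≤1))
        (g-increment 0<R R≤1 0≤ρ (difference-nonneg v≤1) 1-v≤1-u (1-y≤1 0≤u) left-end right-end)
        where
        1-v≤1-u : 1# - v ≤ 1# - u
        1-v≤1-u = +-monoʳ-≤ 1# (≤-by-difference (difference-nonneg u≤v)
          (solve 2 (λ u v → (:- u) :- (:- v) := v :- u) refl u v))
      -- Mirror image: `v` is raised to ½, which does not exceed the right end because ½ ≤ x.
      ... | inj₁ v≤½ = ≤-trans
        (≤-difference-right
          (≤-trans (Φ≤0 v≤½) (difference-nonneg (g≤4/3 ≤-refl))) (right≤Φ 0≤u u≤1))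
        (g-increment 0<R R≤1 0≤ρ 0≤½ (y≤½⇒½≤1-y (≤-trans u≤v v≤½)) (1-y≤1 0≤u)
          (≤-trans 1-R-ρ≤1-R (≤-trans (≤-reflexive 1-R≈1-x) (½≤y⇒1-y≤½ ½≤x))) right-end)
        where
        1-R-ρ≤1-R : 1# - R - ρ ≤ 1# - R
        1-R-ρ≤1-R = ≤-by-difference 0≤ρ
          (solve 2 (λ R ρ → (con 1ℤ :- R) :- (con 1ℤ :- R :- ρ) := ρ) refl R ρ)
        1-R≈1-x : 1# - R ≈ 1# - x
        1-R≈1-x = +-congˡ (-‿cong R≈x)

    bound : x ≤ 1# - x ⊎ 1# - x ≤ x → Φ v - Φ u ≤ ρ * R ⁻¹
    bound (inj₁ x≤1-x) = Left.left x≤1-x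
    bound (inj₂ 1-x≤x) = Right.right 1-x≤x

-- Integrals of piecewise constant functions.

module PiecesProperties {c ℓ₁ ℓ₂} (F : OrderedField c ℓ₁ ℓ₂) where
  open OrderedField F hiding (zero)
  open OrderedFieldProperties F
  open StripCover F
  open Solver

  Integral≈ : (Carrier → Carrier) → Carrier → Carrier → Set _
  Integral≈ f s A = ∃ λ (p : Pieces f s) → finalValue p ≈ 0# × area p ≈ A

  module _ {f g : Carrier → Carrier} (w : Carrier) where

    private
      h : Carrier → Carrier
      h t = w * f t + g t

      values : ∀ {t v u} → f t ≈ v → g t ≈ u → h t ≈ w * v + u
      values f≈v g≈u = +-cong (*-congˡ f≈v) g≈u

    integral-zero-add : ∀ {s} → (∀ t → s < t → f t ≈ 0#) →
      (q : Pieces g s) → finalValue q ≈ 0# → Integral≈ h s (area q)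
    integral-zero-add f≈0 (last u g≈u) u≈0 =
      last (w * 0# + u) (λ t s<t → values (f≈0 t s<t) (g≈u t s<t)) ,
      trans (trans (+-congʳ (zeroʳ w)) (+-identityˡ u)) u≈0 , refl
    integral-zero-add {s} f≈0 (piece s′ u s≤s′ g≈u q) q-final≈0
      with integral-zero-add (λ t s′<t → f≈0 t (≤-<-trans s≤s′ s′<t)) q q-final≈0
    ... | r , r-final≈0 , area≈ =
      piece s′ (w * 0# + u) s≤s′ (λ t s<t t<s′ → values (f≈0 t s<t) (g≈u t s<t t<s′)) r ,
      r-final≈0 ,
      +-cong (*-congʳ (trans (+-congʳ (zeroʳ w)) (+-identityˡ u))) area≈

    mutual
      integral-axpy : ∀ {s} (p : Pieces f s) (q : Pieces g s) →
        finalValue p ≈ 0# → finalValue q ≈ 0# → Integral≈ h s (w * area p + area q)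
      integral-axpy (last v f≈v) q v≈0 q-final≈0
        with integral-zero-add (λ t s<t → trans (f≈v t s<t) v≈0) q q-final≈0
      ... | r , r-final≈0 , area≈ =
        r , r-final≈0 , trans area≈ (sym (trans (+-congʳ (zeroʳ w)) (+-identityˡ _)))
      integral-axpy (piece s′ v s≤s′ f≈v p) q = integral-piece-axpy s≤s′ f≈v p q

      -- The first piece of `f` is passed unpacked, since a breakpoint of `g` may fall inside it.
      -- The merge cuts at the earlier breakpoint: either `p` is taken up next, or the first piece
      -- is shortened from the left and the recursion descends in `q` with `p` unchanged.
      integral-piece-axpy : ∀ {s s′ v} → s ≤ s′ → (∀ t → s < t → t < s′ → f t ≈ v) →
        (p : Pieces f s′) (q : Pieces g s) → finalValue p ≈ 0# → finalValue q ≈ 0# →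
        Integral≈ h s (w * (v * (s′ - s) + area p) + area q)
      integral-piece-axpy {s} {s′} {v} s≤s′ f≈v p (last u g≈u) p-final≈0 u≈0
        with integral-axpy p (last u (λ t s′<t → g≈u t (≤-<-trans s≤s′ s′<t))) p-final≈0 u≈0
      ... | r , r-final≈0 , area≈ =
        piece s′ (w * v + u) s≤s′ (λ t s<t t<s′ → values (f≈v t s<t t<s′) (g≈u t s<t)) r ,
        r-final≈0 ,
        trans (+-cong (*-congʳ (trans (+-congˡ u≈0) (+-identityʳ _))) area≈)
          (solve 5 (λ w v s s′ A → w :* v :* (s′ :- s) :+ (w :* A :+ con 0ℤ) :=
            w :* (v :* (s′ :- s) :+ A) :+ con 0ℤ) refl w v s s′ (area p))
      integral-piece-axpy {s} {s′} {v} s≤s′ f≈v p (piece s″ u s≤s″ g≈u q) p-final≈0 q-final≈0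
        with s′ ≤? s″
      ... | yes s′≤s″
        with integral-axpy p
          (piece s″ u s′≤s″ (λ t s′<t → g≈u t (≤-<-trans s≤s′ s′<t)) q) p-final≈0 q-final≈0
      ...   | r , r-final≈0 , area≈ =
        piece s′ (w * v + u) s≤s′
          (λ t s<t t<s′ → values (f≈v t s<t t<s′) (g≈u t s<t (<-≤-trans t<s′ s′≤s″))) r ,
        r-final≈0 ,
        trans (+-congˡ area≈)
          (solve 8 (λ w v u s s′ s″ A B →
            (w :* v :+ u) :* (s′ :- s) :+ (w :* A :+ (u :* (s″ :- s′) :+ B)) :=
            w :* (v :* (s′ :- s) :+ A) :+ (u :* (s″ :- s) :+ B))
            refl w v u s s′ s″ (area p) (area q))
      integral-piece-axpy {s} {s′} {v} s≤s′ f≈v p (piece s″ u s≤s″ g≈u q) p-final≈0 q-final≈0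
        | no s″<s′
        with integral-piece-axpy (<⇒≤ s″<s′) (λ t s″<t → f≈v t (≤-<-trans s≤s″ s″<t)) p q
          p-final≈0 q-final≈0
      ...   | r , r-final≈0 , area≈ =
        piece s″ (w * v + u) s≤s″
          (λ t s<t t<s″ → values (f≈v t s<t (<-≤-trans t<s″ (<⇒≤ s″<s′))) (g≈u t s<t t<s″)) r ,
        r-final≈0 ,
        trans (+-congˡ area≈)
          (solve 8 (λ w v u s s′ s″ A B →
            (w :* v :+ u) :* (s″ :- s) :+ (w :* (v :* (s′ :- s″) :+ A) :+ B) :=
            w :* (v :* (s′ :- s) :+ A) :+ (u :* (s″ :- s) :+ B))
            refl w v u s s′ s″ (area p) (area q))

  integral-sum : ∀ {n s} (w : Fin n → Carrier) {f : Fin n → Carrier → Carrier}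
    (p : ∀ i → Pieces (f i) s) → (∀ i → finalValue (p i) ≈ 0#) →
    Integral≈ (λ t → sum λ i → w i * f i t) s (sum λ i → w i * area (p i))
  integral-sum {ℕ.zero} w p p-final≈0 = last 0# (λ _ _ → refl) , refl , refl
  integral-sum {ℕ.suc n} w p p-final≈0
    with integral-sum (w ∘ suc) (p ∘ suc) (p-final≈0 ∘ suc)
  ... | q , q-final≈0 , q-area≈ with integral-axpy (w zero) (p zero) q (p-final≈0 zero) q-final≈0
  ...   | r , r-final≈0 , area≈ = r , r-final≈0 , trans area≈ (+-congˡ q-area≈)

  module _ {f : Carrier → Carrier} where

    -- On an empty piece `v` is unrelated to `f`, so areas are compared instead of values. Otherwise
    -- a midpoint serves as a sample that relates `κ` to `v`.
    piece-area-bound : ∀ {κ s s′ v} → s ≤ s′ → (∀ t → s < t → t < s′ → f t ≈ v) →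
      (∀ t → s < t → t < s′ → κ ≤ f t) → κ * (s′ - s) ≤ v * (s′ - s)
    piece-area-bound {κ} {s} {s′} {v} s≤s′ f≈v κ≤f with s′ ≤? s
    ... | no s<s′ with <-dense s<s′
    ...   | m , s<m , m<s′ = ≤-by-difference
      (*-nonneg (difference-nonneg (≤-trans (κ≤f m s<m m<s′) (≤-reflexive (f≈v m s<m m<s′))))
        (difference-nonneg s≤s′))
      (solve 3 (λ κ v d → v :* d :- κ :* d := (v :- κ) :* d) refl κ v (s′ - s))
    piece-area-bound {κ} {s} {s′} {v} s≤s′ f≈v κ≤f | yes s′≤s =
      ≤-reflexive (trans (collapse κ) (sym (collapse v)))
      where
      open DecTotalOrder decTotalOrder using (antisym)
      collapse : ∀ k → k * (s′ - s) ≈ 0#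
      collapse k = trans (*-congˡ (trans (+-congʳ (antisym s′≤s s≤s′)) (-‿inverseʳ s))) (zeroʳ k)

    area-nonneg : ∀ {s} (p : Pieces f s) → (∀ t → s < t → 0# ≤ f t) → 0# ≤ area p
    area-nonneg (last _ _) 0≤f = ≤-refl
    area-nonneg {s} (piece s′ v s≤s′ f≈v p) 0≤f = +-nonneg
      (≤-trans (≤-reflexive (sym (zeroˡ _))) (piece-area-bound s≤s′ f≈v (λ t s<t _ → 0≤f t s<t)))
      (area-nonneg p (λ t s′<t → 0≤f t (≤-<-trans s≤s′ s′<t)))

    area-bound : ∀ {κ T s} → 0# < κ → (p : Pieces f s) → finalValue p ≈ 0# →
      (∀ t → s < t → 0# ≤ f t) → (∀ t → s < t → t < T → κ ≤ f t) → κ * (T - s) ≤ area p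
    area-bound {κ} {T} {s} 0<κ p p-final≈0 0≤f κ≤f with T ≤? s
    ... | yes T≤s = ≤-trans
      (≤-by-difference (*-nonneg (<⇒≤ 0<κ) (difference-nonneg T≤s))
        (solve 3 (λ κ T s → con 0ℤ :- κ :* (T :- s) := κ :* (s :- T)) refl κ T s))
      (area-nonneg p 0≤f)
    -- The last piece cannot begin before `T`: its value is 0, yet `f` is still at least `κ` there.
    area-bound {κ} {T} {s} 0<κ (last v f≈v) v≈0 0≤f κ≤f | no s<T with <-dense s<T
    ... | m , s<m , m<T = contradiction
      (≤-trans (κ≤f m s<m m<T) (≤-reflexive (trans (f≈v m s<m) v≈0))) 0<κ
    area-bound {κ} {T} {s} 0<κ (piece s′ v s≤s′ f≈v p) p-final≈0 0≤f κ≤f | no s<T with T ≤? s′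
    ... | no s′<T = ≤-trans
      (≤-reflexive (solve 4 (λ κ T s s′ → κ :* (T :- s) := κ :* (s′ :- s) :+ κ :* (T :- s′))
        refl κ T s s′))
      (+-mono-≤
        (piece-area-bound s≤s′ f≈v (λ t s<t t<s′ → κ≤f t s<t (<-≤-trans t<s′ (<⇒≤ s′<T))))
        (area-bound 0<κ p p-final≈0 (λ t s′<t → 0≤f t (≤-<-trans s≤s′ s′<t))
          (λ t s′<t → κ≤f t (≤-<-trans s≤s′ s′<t))))
    -- The bound by `κ` holds only before `T`. A sample in (s, T) carries it to the constant `v`,
    -- hence to the whole piece, and κ (s′ - T) is surplus.
    ... | yes T≤s′ with <-dense s<T
    ...   | m , s<m , m<T = ≤-by-difference
      (+-nonneg (+-nonneg
        (*-nonneg (difference-nonneg κ≤v) (difference-nonneg s≤s′))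
        (*-nonneg (<⇒≤ 0<κ) (difference-nonneg T≤s′)))
        (area-nonneg p (λ t s′<t → 0≤f t (≤-<-trans s≤s′ s′<t))))
      (solve 6 (λ κ v T s s′ A → (v :* (s′ :- s) :+ A) :- κ :* (T :- s) :=
        ((v :- κ) :* (s′ :- s) :+ κ :* (s′ :- T)) :+ A) refl κ v T s s′ (area p))
      where
      κ≤v : κ ≤ v
      κ≤v = ≤-trans (κ≤f m s<m m<T) (≤-reflexive (f≈v m s<m (<-≤-trans m<T T≤s′)))

-- Consecutive turns.

module Turns {c ℓ₁ ℓ₂} (F : OrderedField c ℓ₁ ℓ₂) where
  open OrderedField F hiding (zero)
  open OrderedFieldProperties F
  open Solver

  -- Agrees with `turnStart` by computation, but for arbitrary lengths, so that induction can drop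
  -- the first turn.
  start : ∀ {n} → (Fin n → Carrier) → Fin n → Carrier
  start a i = sum λ (j : Fin (toℕ i)) → a (inject {i = i} j)

  start-first : ∀ {n} (a : Fin n → Carrier) i → toℕ i ≡ 0 → start a i ≡ 0#
  start-first a zero _ = ≡.refl

  end≤sum : ∀ {n} (a : Fin n → Carrier) → (∀ i → 0# ≤ a i) → ∀ i → start a i + a i ≤ sum a
  end≤sum a 0≤a zero = ≤-trans (≤-reflexive (+-comm 0# (a zero)))
    (+-monoʳ-≤ (a zero) (sum-nonneg (0≤a ∘ suc)))
  end≤sum a 0≤a (suc i) = ≤-trans (≤-reflexive (+-assoc _ _ _))
    (+-monoʳ-≤ (a zero) (end≤sum (a ∘ suc) (0≤a ∘ suc) i))

  find-turn : ∀ {n} (a : Fin n → Carrier) {t} → 0# < t → t ≤ sum a →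
    ∃ λ i → start a i < t × t ≤ start a i + a i
  find-turn {ℕ.zero} a 0<t t≤0 = contradiction t≤0 0<t
  find-turn {ℕ.suc n} a {t} 0<t t≤sum with t ≤? a zero
  ... | yes t≤a₀ = zero , 0<t , ≤-trans t≤a₀ (≤-reflexive (sym (+-identityˡ _)))
  ... | no a₀<t with find-turn (a ∘ suc) {t - a zero} 0<t-a₀
      (≤-by-difference (difference-nonneg t≤sum)
        (solve 3 (λ t a S → S :- (t :- a) := (a :+ S) :- t) refl t (a zero) (sum (a ∘ suc))))
    where
    0<t-a₀ : 0# < t - a zero
    0<t-a₀ t-a₀≤0 = a₀<t (≤-by-difference (difference-nonneg t-a₀≤0)
      (solve 2 (λ t a → a :- t := con 0ℤ :- (t :- a)) refl t (a zero)))
  ...   | i , s<t-a₀ , t-a₀≤e = suc i ,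
      (λ t≤a₀+s → s<t-a₀ (≤-by-difference (difference-nonneg t≤a₀+s)
        (solve 3 (λ t a s → s :- (t :- a) := (a :+ s) :- t) refl t (a zero) (start (a ∘ suc) i)))) ,
      ≤-by-difference (difference-nonneg t-a₀≤e)
        (solve 4 (λ t a s e → ((a :+ s) :+ e) :- t := (s :+ e) :- (t :- a)) refl
          t (a zero) (start (a ∘ suc) i) (a (suc i)))

-- Round robin against an arbitrary solution.

module StripCoverProperties {c ℓ₁ ℓ₂} (F : OrderedField c ℓ₁ ℓ₂) {n : ℕ}
  (I : StripCover.Instance F n) where
  open OrderedField F hiding (zero)
  open OrderedFieldProperties F
  open Potential F
  open PiecesProperties F
  open Turns F
  open StripCover F
  open Instance I
  open Solver
  open Max totalOrder using (x≤x⊔y; x≤y⊔x)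

  0<r : ∀ i → 0# < r I i
  0<r i = max-x-1-x>0 (x i)

  0≤r : ∀ i → 0# ≤ r I i
  0≤r i = <⇒≤ (0<r i)

  0≤r⁻¹ : ∀ i → 0# ≤ r I i ⁻¹
  0≤r⁻¹ i = ⁻¹-nonneg (0<r i)

  r-covers : ∀ i {y} → 0# ≤ y → y ≤ 1# → x i - r I i ≤ y × y ≤ x i + r I i
  r-covers i {y} 0≤y y≤1 =
    ≤-by-difference (+-nonneg 0≤y (difference-nonneg (x≤x⊔y (x i) (1# - x i))))
      (solve 3 (λ x r y → y :- (x :- r) := y :+ (r :- x)) refl (x i) (r I i) y) ,
    ≤-by-difference (+-nonneg (difference-nonneg y≤1) (difference-nonneg (x≤y⊔x (x i) (1# - x i))))
      (solve 3 (λ x r y → (x :+ r) :- y := (con 1ℤ :- y) :+ (r :- (con 1ℤ :- x))) refl (x i) (r I i) y)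

  ⅔≤cover-cost : ∀ {ρ : Radii I} {t} → (∀ i → 0# ≤ ρ i t) → CoveredAt I ρ t →
    ⅔ ≤ sum λ i → r I i ⁻¹ * ρ i t
  ⅔≤cover-cost {ρ} {t} 0≤ρ covered = ≤-trans ⅔≤Φ1-Φ0
    (cover-bound Φ (λ i → x i - ρ i t) (λ i → x i + ρ i t) (λ i → r I i ⁻¹ * ρ i t)
      (λ i → *-nonneg (0≤r⁻¹ i) (0≤ρ i))
      (λ i 0≤u u≤v v≤1 l≤u v≤r → ≤-trans
        (Φ-increment (0≤x i) (x≤1 i) (0≤ρ i) 0≤u u≤v v≤1 l≤u v≤r)
        (≤-reflexive (*-comm _ _)))
      0<1 ≤-refl (λ y 0≤y y<1 → covered y 0≤y (<⇒≤ y<1)))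

  0<⅔ : 0# < ⅔
  0<⅔ ⅔≤0 = 0<1 (≤-trans
    (≤-reflexive (modulo 3*⅓≈1 (modulo 2*½≈1 (solve 2 (λ τ h →
      con 1ℤ := (three :* h :* (two :* τ) :+ (:- (two :* h)) :* (three :* τ :- con 1ℤ))
        :+ (:- con 1ℤ) :* (two :* h :- con 1ℤ)) refl ⅓ ½))))
    (≤-trans (*-monoˡ-≤ (*-nonneg (fromℤ⁺-nonneg 3) 0≤½) ⅔≤0) (≤-reflexive (zeroʳ _))))

  ⅔T≤RR : ∀ {ρ T} → IsSolution I ρ → CoveredUntil I ρ T → ⅔ * T ≤ RR I
  ⅔T≤RR {ρ} {T} solution (0≤T , covered)
    -- Sensors change radius at different times, so their pieces are merged into one function, the
    -- total cost, before the pointwise bound is integrated.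
    with integral-sum (λ i → r I i ⁻¹) (IsSolution.pieces solution) (proj₁ ∘ IsSolution.budget solution)
  ... | p , p-final≈0 , area≈ = ≤-trans
    (≤-reflexive (*-congˡ (solve 1 (λ T → T := T :- con 0ℤ) refl T)))
    (≤-trans
      (area-bound 0<⅔ p p-final≈0
        (λ t 0<t → sum-nonneg λ i → *-nonneg (0≤r⁻¹ i) (0≤ρ i t (<⇒≤ 0<t)))
        (λ t 0<t t<T → ⅔≤cover-cost {ρ} (λ i → 0≤ρ i t (<⇒≤ 0<t)) (covered t (<⇒≤ 0<t) (<⇒≤ t<T))))
      (≤-trans (≤-reflexive area≈)
        (sum-mono-≤ λ i → ≤-trans (*-monoˡ-≤ (0≤r⁻¹ i) (proj₂ (budget i))) (≤-reflexive (*-comm _ _)))))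
    where open IsSolution solution

  0≤turnLength : ∀ i → 0# ≤ turnLength I i
  0≤turnLength i = *-nonneg (fromℚ-nonneg (b i) (0≤b i)) (0≤r⁻¹ i)

  0≤turnStart : ∀ i → 0# ≤ turnStart I i
  0≤turnStart i = sum-nonneg (λ (j : Fin (toℕ i)) → 0≤turnLength (inject {i = i} j))

  0≤RR : 0# ≤ RR I
  0≤RR = sum-nonneg 0≤turnLength

  turnStart≤turnEnd : ∀ i → turnStart I i ≤ turnEnd I i
  turnStart≤turnEnd i = ≤-trans (≤-reflexive (sym (+-identityʳ _))) (+-monoʳ-≤ _ (0≤turnLength i))

  roundRobin-active : ∀ {i t} → Active I i t → roundRobin I i t ≡ r I i
  roundRobin-active {i} {t} active =
    ≡.cong (if_then r I i else 0#) (dec-true (active? I i t) active)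

  roundRobin-inactive : ∀ {i t} → ¬ Active I i t → roundRobin I i t ≡ 0#
  roundRobin-inactive {i} {t} inactive =
    ≡.cong (if_then r I i else 0#) (dec-false (active? I i t) inactive)

  Active-resp-≈ : ∀ {i s t} → s ≈ t → Active I i s → Active I i t
  Active-resp-≈ s≈t (inj₁ first , s≤e) = inj₁ first , ≤-trans (≤-reflexive (sym s≈t)) s≤e
  Active-resp-≈ s≈t (inj₂ b<s , s≤e) =
    inj₂ (<-≤-trans b<s (≤-reflexive s≈t)) , ≤-trans (≤-reflexive (sym s≈t)) s≤e

  roundRobin-isSolution : IsSolution I (roundRobin I)
  roundRobin-isSolution = record
    { ρ-cong = ρ-cong
    ; 0≤ρ    = 0≤ρ
    ; pieces = pieces
    ; budget = λ i → refl , ≤-reflexive (area≈ i)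
    }
    where
    ρ-cong : ∀ i {s t} → s ≈ t → roundRobin I i s ≈ roundRobin I i t
    ρ-cong i {s} {t} s≈t = byActivity (active? I i s)
      where
      byActivity : Dec (Active I i s) → roundRobin I i s ≈ roundRobin I i t
      byActivity (yes a) = reflexive (≡.trans (roundRobin-active a)
        (≡.sym (roundRobin-active (Active-resp-≈ s≈t a))))
      byActivity (no ¬a) = reflexive (≡.trans (roundRobin-inactive ¬a)
        (≡.sym (roundRobin-inactive (¬a ∘ Active-resp-≈ (sym s≈t)))))

    0≤ρ : ∀ i t → 0# ≤ t → 0# ≤ roundRobin I i t
    0≤ρ i t _ = nonneg (does (active? I i t))
      where
      nonneg : ∀ active → 0# ≤ (if active then r I i else 0#)
      nonneg true  = 0≤r i
      nonneg false = ≤-refl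

    before : ∀ i t → 0# < t → t < turnStart I i → ¬ Active I i t
    -- `Active` does not consult `turnStart` for the first sensor, but that turn starts at 0 and no
    -- positive time precedes it.
    before i t 0<t t<s (inj₁ first , _) = t<s
      (≤-trans (≤-reflexive (reflexive (start-first (turnLength I) i first))) (<⇒≤ 0<t))
    before i t 0<t t<s (inj₂ s<t , _) = s<t (<⇒≤ t<s)

    pieces : ∀ i → Pieces (roundRobin I i) 0#
    pieces i =
      piece (turnStart I i) 0# (0≤turnStart i)
        (λ t 0<t t<s → reflexive (roundRobin-inactive (before i t 0<t t<s)))
      (piece (turnEnd I i) (r I i) (turnStart≤turnEnd i)
        (λ t s<t t<e → reflexive (roundRobin-active (inj₂ s<t , <⇒≤ t<e)))
      (last 0# (λ t e<t → reflexive (roundRobin-inactive (e<t ∘ proj₂)))))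

    area≈ : ∀ i → area (pieces i) ≈ fromℚ (b i)
    area≈ i = modulo (⁻¹-inverse (0<r i)) (solve 4 (λ s r q β →
      con 0ℤ :* (s :- con 0ℤ) :+ (r :* ((s :+ β :* q) :- s) :+ con 0ℤ) :=
        β :+ β :* (r :* q :- con 1ℤ)) refl (turnStart I i) (r I i) (r I i ⁻¹) (fromℚ (b i)))

  -- Positive times fall into a half-open turn. Time 0 falls into none and is assigned to the first
  -- sensor, even if its battery is empty; with no sensor at all, time 0 would be uncovered.
  find-active : NonZero n → ∀ t → 0# ≤ t → t ≤ RR I → ∃ λ i → Active I i t
  find-active n≢0 t 0≤t t≤RR with t ≤? 0#
  ... | no 0<t with find-turn (turnLength I) 0<t t≤RR
  ...   | i , s<t , t≤e = i , inj₂ s<t , t≤e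
  find-active n≢0 t 0≤t t≤RR | yes t≤0 =
    i₀ , inj₁ (ℕₚ.n<1⇒n≡0 (≡.subst (ℕ._< 1) (≡.sym (toℕ-fromℕ< 0<n)) (ℕ.s≤s ℕ.z≤n))) ,
    ≤-trans t≤0 (≤-trans (0≤turnStart i₀) (turnStart≤turnEnd i₀))
    where
    0<n : 0 ℕ.< n
    0<n = ℕ.>-nonZero⁻¹ n ⦃ n≢0 ⦄
    i₀ : Fin n
    i₀ = Fin.fromℕ< 0<n

  roundRobin-isLifetime : NonZero n → IsLifetime I (roundRobin I) (RR I)
  roundRobin-isLifetime n≢0 = (0≤RR , covered) , maximal
    where
    covered : ∀ t → 0# ≤ t → t ≤ RR I → CoveredAt I (roundRobin I) t
    covered t 0≤t t≤RR y 0≤y y≤1 with find-active n≢0 t 0≤t t≤RR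
    ... | i , active =
      i , ≡.subst (λ ρ → x i - ρ ≤ y × y ≤ x i + ρ) (≡.sym (roundRobin-active active)) (r-covers i 0≤y y≤1)

    -- After time RR all radii are 0, and so is the cost of the cover.
    maximal : ∀ T → CoveredUntil I (roundRobin I) T → T ≤ RR I
    maximal T (0≤T , covered-T) = ≮⇒≥ λ RR<T → 0<⅔ (≤-trans
      (⅔≤cover-cost {roundRobin I} (λ i → IsSolution.0≤ρ roundRobin-isSolution i T 0≤T)
        (covered-T T 0≤T ≤-refl))
      (≤-reflexive (sum-zero λ i → trans
        (*-congˡ (reflexive (roundRobin-inactive λ active →
          RR<T (≤-trans (proj₂ active) (end≤sum (turnLength I) 0≤turnLength i)))))
        (zeroʳ _))))

  T≤3/2RR : ∀ {ρ T} → IsSolution I ρ → CoveredUntil I ρ T → T ≤ fromℚ (+ 3 / 2) * RR I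
  T≤3/2RR {ρ} {T} solution covered = ≤-by-difference
    (*-nonneg (*-nonneg (fromℤ⁺-nonneg 3) 0≤½) (difference-nonneg (⅔T≤RR solution covered)))
    (modulo 3*⅓≈1 (modulo 2*½≈1 (solve 4 (λ τ h T R →
      three :* h :* R :- T :=
        (three :* h :* (R :- two :* τ :* T) :+ (two :* h :* T) :* (three :* τ :- con 1ℤ))
          :+ T :* (two :* h :- con 1ℤ)) refl ⅓ ½ T (RR I))))

theorem3 : ∀ {c ℓ₁ ℓ₂} (F : OrderedField c ℓ₁ ℓ₂) →
    let open OrderedField F
        open StripCover F in
    ∀ {n : ℕ} (I : Instance n) →
      (∀ opt → IsOpt I opt → fromℚ (+ 2 / 3) * opt ≤ RR I)
      × (NonZero n →
           IsLifetime I (roundRobin I) (RR I)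
           × IsApproximation I (+ 3 / 2) (roundRobin I))
theorem3 F I =
  (λ { opt ((ρ , solution , covered , _) , _) → ⅔T≤RR solution covered }) ,
  λ n≢0 → roundRobin-isLifetime n≢0 , record
    { isSolution = roundRobin-isSolution
    ; lifetime   = StripCover.RR F I
    ; isLifetime = roundRobin-isLifetime n≢0
    ; ratio      = λ ρ T → T≤3/2RR
    }
  where open StripCoverProperties F I
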